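{- There is $k_0$ such that for every $k\ge k_0$ the following holds. Let $G$ be a finite graph with chromatic number $\chi(G)=k$, and let $H_1,\dots,H_r$ be bicliques (complete bipartite subgraphs of $G$) whose union covers every edge of $G$. Then $$\sum_{i=1}^r |V(H_i)| \ \ge\ k\log_2 k - k\log_2\log_2 k - k\log_2\log_2\log_2 k.$$
   Context: A biclique is a complete bipartite graph $(A,B)$; its order $|V(H)|=|A|+|B|$ is its number of vertices. The bicliques need not be edge-disjoint. All logarithms are to base 2. -}

module Defs where

open import Data.Nat using (ℕ; suc; _+_; _*_; _^_; _≤_; _<_)
open import Data.Bool using (Bool; true; false)
open import Data.Fin using (Fin)
open import Data.Fin.Subset using (Subset; _∈_; ∣_∣)
open import Data.List using (List; map)
open import Data.Nat.ListAction using (sum)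
open import Data.List.Membership.Propositional renaming (_∈_ to _∈ᴸ_)
open import Data.Product using (Σ; _×_; ∃-syntax)
open import Data.Sum using (_⊎_)
open import Relation.Binary.PropositionalEquality using (_≡_; _≢_)
open import Relation.Nullary using (¬_)

record Graph (n : ℕ) : Set where
  field
    adj   : Fin n → Fin n → Bool
    sym   : ∀ u v → adj u v ≡ adj v u
    irrefl : ∀ v → adj v v ≡ false
open Graph public

Colourable : ∀ {n} → Graph n → ℕ → Set
Colourable {n} G c =
  Σ (Fin n → Fin c) λ f → ∀ u v → adj G u v ≡ true → f u ≢ f v

ChromaticNumber : ∀ {n} → Graph n → ℕ → Set
ChromaticNumber G k = Colourable G k × (∀ j → j < k → ¬ Colourable G j)

-- A biclique (complete bipartite subgraph) of G with sides A, B: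
-- every vertex of A is adjacent to every vertex of B.
-- (A and B are automatically disjoint since adj is irreflexive.)
record Biclique {n : ℕ} (G : Graph n) : Set where
  field
    sideA : Subset n
    sideB : Subset n
    complete : ∀ u v → u ∈ sideA → v ∈ sideB → adj G u v ≡ true
open Biclique public

order : ∀ {n} {G : Graph n} → Biclique G → ℕ
order H = ∣ sideA H ∣ + ∣ sideB H ∣

Covers : ∀ {n} (G : Graph n) → List (Biclique G) → Set
Covers {n} G Hs = ∀ u v → adj G u v ≡ true →
  ∃[ H ] (H ∈ᴸ Hs × ((u ∈ sideA H × v ∈ sideB H) ⊎ (v ∈ sideA H × u ∈ sideB H)))

totalOrder : ∀ {n} {G : Graph n} → List (Biclique G) → ℕ
totalOrder Hs = sum (map order Hs)

-- Real-free encoding of  S ≥ k log k − k log log k − k log log log k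
-- (logs base 2).  With a = log k, b = log a, the inequality is
-- 2^S · (a·b)^k ≥ k^k  (for k ≥ 3, so that a·b > 0).  Since a·b is the
-- infimum of p·q over rationals p = pn/pd ≥ a and q = qn/qd ≥ log p,
-- it is equivalent to: for all such p, q,  2^S (p q)^k ≥ k^k.
--   p ≥ log k      ⇔ k^pd ≤ 2^pn
--   q ≥ log p      ⇔ pn^qd ≤ 2^qn · pd^qd
BoundHolds : ℕ → ℕ → Set
BoundHolds k S =
  ∀ pn pd qn qd → 1 ≤ pd → 1 ≤ qd →
  k ^ pd ≤ 2 ^ pn →
  pn ^ qd ≤ 2 ^ qn * pd ^ qd →
  k ^ k * (pd * qd) ^ k ≤ 2 ^ S * (pn * qn) ^ k

{-# OPTIONS --safe #-}

-- Fix T and put N = 2^T. Deleting from each biclique one of its two sides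
-- leaves an independent set, and for a random choice of sides a vertex v lying
-- in d(v) bicliques survives with probability 2^-d(v). Take N such random
-- independent sets as colour classes and give every vertex that is still
-- uncoloured its own colour; this is made deterministic by weights. Since
-- (1 - 2^-d)^N ≤ d/T for all d, the number of uncoloured vertices is at most
-- S/T with S = Σ d(v) the total order, so T k ≤ T 2^T + S for every T.
-- Taking 2^T ≈ k / log k gives S ≥ k log k - k log log k - 2k, and
-- log log log k ≥ 2 as soon as k ≥ 2^16.
module Submission where

open import Defs hiding (sym)
open import Data.Bool using (Bool; true; false; if_then_else_; not; _∧_)
open import Data.Empty using (⊥; ⊥-elim)
open import Data.Fin using (Fin; zero; suc; fromℕ<)
open import Data.Fin.Properties using (fromℕ<-injective)
open import Data.Fin.Subset using (Subset; ∣_∣)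
open import Data.List using (List; []; _∷_)
open import Data.List.Membership.Propositional renaming (_∈_ to _∈ᴸ_)
open import Data.List.Relation.Unary.Any using (here; there)
open import Data.Nat using (ℕ; zero; suc; _+_; _*_; _∸_; _^_; _≤_; _<_; _≥_; z≤n; s≤s; >-nonZero)
open import Data.Nat.Properties
open import Data.Nat.Tactic.RingSolver using (solve-∀)
open import Data.Product using (Σ-syntax; _×_; _,_; ∃-syntax)
open import Data.Sum using (_⊎_; inj₁; inj₂)
open import Data.Vec using (lookup; []; _∷_)
open import Data.Vec.Properties using ([]=⇒lookup; lookup⇒[]=)
open import Function using (_∘_; case_of_)
open import Relation.Binary.PropositionalEquality
  using (_≡_; _≢_; refl; sym; trans; cong; cong₂; subst; subst₂)
open import Relation.Nullary using (yes; no)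
open import Algebra.Properties.Semiring.Sum +-*-semiring
  using (sum; ∑-distrib-+; *-distribˡ-sum; sum-cong-≗)

private
  variable
    n : ℕ

-- Powers

n<2^n : ∀ n → n < 2 ^ n
n<2^n zero    = s≤s z≤n
n<2^n (suc n) = begin-strict
  suc n            ≡⟨ +-comm 1 n ⟩
  n + 1            <⟨ +-mono-<-≤ (n<2^n n) (m^n>0 2 n) ⟩
  2 ^ n + 2 ^ n    ≡⟨ cong (2 ^ n +_) (sym (+-identityʳ (2 ^ n))) ⟩
  2 ^ suc n        ∎
  where open ≤-Reasoning

^-distribʳ-* : ∀ m n o → (m * n) ^ o ≡ m ^ o * n ^ o
^-distribʳ-* m n zero    = refl
^-distribʳ-* m n (suc o) = trans (cong (m * n *_) (^-distribʳ-* m n o))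
                                 ([m*n]*[o*p]≡[m*o]*[n*p] m n (m ^ o) (n ^ o))

^-cancelʳ-≤ : ∀ m {n o} → 1 < m → m ^ n ≤ m ^ o → n ≤ o
^-cancelʳ-≤ m 1<m le = ≮⇒≥ λ o<n → ≤⇒≯ le (^-monoʳ-< m 1<m o<n)

-- The left side is the first two terms of the binomial expansion. The induction multiplies by
-- `suc x` and drops the surplus `suc n * p`.
bernoulli : ∀ x n → x ^ suc n + suc n * x ^ n ≤ suc x ^ suc n
bernoulli x zero    = ≤-reflexive (identity x)
  where
  identity : ∀ x → x * 1 + 1 ≡ suc x * 1
  identity = solve-∀
bernoulli x (suc n) = begin
  x * (x * p) + (2 + n) * (x * p)              ≤⟨ m≤m+n _ (suc n * p) ⟩
  x * (x * p) + (2 + n) * (x * p) + suc n * p  ≡⟨ identity x n p ⟩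
  suc x * (x * p + suc n * p)                  ≤⟨ *-monoʳ-≤ (suc x) (bernoulli x n) ⟩
  suc x * suc x ^ suc n                        ∎
  where
  open ≤-Reasoning
  p = x ^ n
  identity : ∀ x n p → x * (x * p) + (2 + n) * (x * p) + suc n * p ≡ suc x * (x * p + suc n * p)
  identity = solve-∀

-- Cleared of denominators, this is (1 - 1/(1+x))^(1+x) ≤ 1/2. For 1 + x = 2^d it says that every
-- 2^d colour classes halve the expected number of uncoloured vertices of degree d.
2*x^[1+x]≤[1+x]^[1+x] : ∀ x → 2 * x ^ suc x ≤ suc x ^ suc x
2*x^[1+x]≤[1+x]^[1+x] x = begin
  2 * x ^ suc x              ≡⟨ cong (x ^ suc x +_) (+-identityʳ (x ^ suc x)) ⟩
  x ^ suc x + x * x ^ x      ≤⟨ +-monoʳ-≤ (x ^ suc x) (*-monoˡ-≤ (x ^ x) (n≤1+n x)) ⟩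
  x ^ suc x + suc x * x ^ x  ≤⟨ bernoulli x x ⟩
  suc x ^ suc x              ∎
  where open ≤-Reasoning

-- ⌊ 2 ^ T / 2 ^ d ⌋
share : ℕ → ℕ → ℕ
share T       zero    = 2 ^ T
share zero    (suc d) = 0
share (suc T) (suc d) = share T d

share*2^d≤2^T : ∀ T d → share T d * 2 ^ d ≤ 2 ^ T
share*2^d≤2^T T       zero    = ≤-reflexive (*-identityʳ (2 ^ T))
share*2^d≤2^T zero    (suc d) = z≤n
share*2^d≤2^T (suc T) (suc d) = begin
  share T d * (2 * 2 ^ d)  ≡⟨ identity (share T d) (2 ^ d) ⟩
  2 * (share T d * 2 ^ d)  ≤⟨ *-monoʳ-≤ 2 (share*2^d≤2^T T d) ⟩
  2 * 2 ^ T                ∎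
  where
  open ≤-Reasoning
  identity : ∀ s p → s * (2 * p) ≡ 2 * (s * p)
  identity = solve-∀

share-+ : ∀ d j → share (d + j) d ≡ 2 ^ j
share-+ zero    j = refl
share-+ (suc d) j = share-+ d j

-- In `uncovered-bound`, where T = d + j, the factor T/d has to be absorbed by the gain
-- `2 ^ (2 ^ j)`. This works because 1 + j ≤ 2^j ≤ 2^(2^j).
d+j≤d*2^2^j : ∀ d j → 1 ≤ d → d + j ≤ d * 2 ^ (2 ^ j)
d+j≤d*2^2^j d j 1≤d = begin
  d + j            ≤⟨ +-monoʳ-≤ d (m≤n*m j d {{>-nonZero 1≤d}}) ⟩
  d + d * j        ≡⟨ *-suc d j ⟨
  d * suc j        ≤⟨ *-monoʳ-≤ d (≤-trans (n<2^n j) (<⇒≤ (n<2^n (2 ^ j)))) ⟩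
  d * 2 ^ (2 ^ j)  ∎
  where open ≤-Reasoning

-- T (1 - 2^-d)^N ≤ d for N = 2^T = a (1 + x), d = T - j, a = 2^j and 2^d = 1 + x.
uncovered-bound : ∀ d j x → 1 ≤ d → let a = 2 ^ j; K = suc x * a in
  (d + j) * (x * a) ^ K ≤ d * (suc x * a) ^ K
uncovered-bound d j x 1≤d = begin
  (d + j) * (x * a) ^ K            ≡⟨ cong ((d + j) *_) (^-distribʳ-* x a K) ⟩
  (d + j) * (x ^ K * a ^ K)        ≤⟨ *-monoˡ-≤ (x ^ K * a ^ K) (d+j≤d*2^2^j d j 1≤d) ⟩
  d * 2 ^ a * (x ^ K * a ^ K)      ≡⟨ identity d (2 ^ a) (x ^ K) (a ^ K) ⟩
  d * (2 ^ a * x ^ K * a ^ K)      ≤⟨ *-monoʳ-≤ d (*-monoˡ-≤ (a ^ K) power) ⟩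
  d * (suc x ^ K * a ^ K)          ≡⟨ cong (d *_) (^-distribʳ-* (suc x) a K) ⟨
  d * (suc x * a) ^ K              ∎
  where
  open ≤-Reasoning
  a = 2 ^ j
  K = suc x * a
  identity : ∀ d b p q → d * b * (p * q) ≡ d * (b * p * q)
  identity = solve-∀
  -- The exponent `K` splits into `a` blocks of length `suc x`, each gaining a factor 2.
  power : 2 ^ a * x ^ K ≤ suc x ^ K
  power = begin
    2 ^ a * x ^ K              ≡⟨ cong (2 ^ a *_) (^-*-assoc x (suc x) a) ⟨
    2 ^ a * (x ^ suc x) ^ a    ≡⟨ ^-distribʳ-* 2 (x ^ suc x) a ⟨
    (2 * x ^ suc x) ^ a        ≤⟨ ^-monoˡ-≤ a (2*x^[1+x]≤[1+x]^[1+x] x) ⟩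
    (suc x ^ suc x) ^ a        ≡⟨ ^-*-assoc (suc x) (suc x) a ⟩
    suc x ^ K                  ∎

-- This is (1 - 2^-d)^N ≤ d/T with N = 2^T. For d ≤ T the share is exactly 2^(T-d); for T ≤ d the
-- right side already exceeds T N^N, so rounding does no harm.
share-bound : ∀ T d → T * (2 ^ T ∸ share T d) ^ (2 ^ T) ≤ d * (2 ^ T) ^ (2 ^ T)
share-bound T d with ≤-total T d
... | inj₁ T≤d = *-mono-≤ T≤d (^-monoˡ-≤ (2 ^ T) (m∸n≤m (2 ^ T) (share T d)))
... | inj₂ d≤T with d | T ∸ d in eq
-- For d = 0 the share is all of `2 ^ T`, so the base is 0 while the exponent is positive.
...   | zero   | _ = ≤-reflexive (trans (cong (T *_) (zero-power (n∸n≡0 (2 ^ T)) (m^n>0 2 T))) (*-zeroʳ T))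
  where
  zero-power : ∀ {m o} → m ≡ 0 → 0 < o → m ^ o ≡ 0
  zero-power refl (s≤s _) = refl
...   | suc d′ | j = subst (λ t → t * (2 ^ t ∸ share t D) ^ (2 ^ t) ≤ D * (2 ^ t) ^ (2 ^ t))
                       (trans (cong (D +_) (sym eq)) (m+[n∸m]≡n d≤T)) bound
  where
  D = suc d′
  x = 2 ^ D ∸ 1
  2^D≡1+x : 2 ^ D ≡ suc x
  2^D≡1+x = sym (m+[n∸m]≡n (m^n>0 2 D))
  total : 2 ^ (D + j) ≡ suc x * 2 ^ j
  total = trans (^-distribˡ-+-* 2 D j) (cong (_* 2 ^ j) 2^D≡1+x)
  rest : 2 ^ (D + j) ∸ share (D + j) D ≡ x * 2 ^ j
  rest = trans (cong₂ _∸_ total (share-+ D j)) (m+n∸m≡n (2 ^ j) (x * 2 ^ j))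
  bound : (D + j) * (2 ^ (D + j) ∸ share (D + j) D) ^ (2 ^ (D + j)) ≤ D * (2 ^ (D + j)) ^ (2 ^ (D + j))
  bound = subst₂ (λ r t → (D + j) * r ^ t ≤ D * t ^ t) (sym rest) (sym total)
            (uncovered-bound D j x (s≤s z≤n))

-- Sums and subsets

sum-mono-≤ : {f g : Fin n → ℕ} → (∀ v → f v ≤ g v) → sum f ≤ sum g
sum-mono-≤ {zero}  f≤g = z≤n
sum-mono-≤ {suc n} f≤g = +-mono-≤ (f≤g zero) (sum-mono-≤ (f≤g ∘ suc))

indicator : Bool → ℕ
indicator b = if b then 1 else 0

∣p∣≡sum : (p : Subset n) → ∣ p ∣ ≡ sum (indicator ∘ lookup p)
∣p∣≡sum []          = refl
∣p∣≡sum (true  ∷ p) = cong suc (∣p∣≡sum p)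
∣p∣≡sum (false ∷ p) = ∣p∣≡sum p

enumerate : (U : Fin n → Bool) → Σ[ f ∈ (Fin n → ℕ) ]
  (∀ v → U v ≡ true → f v < sum (indicator ∘ U)) ×
  (∀ u v → U u ≡ true → U v ≡ true → f u ≡ f v → u ≡ v)
enumerate {zero}  U = (λ ()) , (λ ()) , (λ ())
enumerate {suc n} U with enumerate (U ∘ suc) | U zero in eq
... | f , f< , inj | true = f′ , f′< , inj′
  where
  f′ : Fin (suc n) → ℕ
  f′ zero    = 0
  f′ (suc v) = suc (f v)
  f′< : ∀ v → U v ≡ true → f′ v < suc (sum (indicator ∘ U ∘ suc))
  f′< zero    _ = s≤s z≤n
  f′< (suc v) p = s≤s (f< v p)
  inj′ : ∀ u v → U u ≡ true → U v ≡ true → f′ u ≡ f′ v → u ≡ v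
  inj′ zero    zero    _ _ _ = refl
  inj′ (suc u) (suc v) p q e = cong suc (inj u v p q (suc-injective e))
... | f , f< , inj | false = f′ , f′< , inj′
  where
  f′ : Fin (suc n) → ℕ
  -- A placeholder: vertex `zero` lies outside `U`, where nothing is claimed.
  f′ zero    = 0
  f′ (suc v) = f v
  f′< : ∀ v → U v ≡ true → f′ v < sum (indicator ∘ U ∘ suc)
  f′< zero    p = case trans (sym eq) p of λ ()
  f′< (suc v) p = f< v p
  inj′ : ∀ u v → U u ≡ true → U v ≡ true → f′ u ≡ f′ v → u ≡ v
  inj′ zero    _       p _ _ = case trans (sym eq) p of λ ()
  inj′ (suc u) zero    _ q _ = case trans (sym eq) q of λ ()
  inj′ (suc u) (suc v) p q e = cong suc (inj u v p q e)

-- Bicliques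

inA inB : {G : Graph n} → Biclique G → Fin n → Bool
inA H = lookup (sideA H)
inB H = lookup (sideB H)

degree : {G : Graph n} → List (Biclique G) → Fin n → ℕ
degree []       v = 0
degree (H ∷ Hs) v = (indicator (inA H v) + indicator (inB H v)) + degree Hs v

-- Double counting of the incidences between vertices and sides of bicliques.
totalOrder≡sum-degree : {G : Graph n} (Hs : List (Biclique G)) → totalOrder Hs ≡ sum (degree Hs)
totalOrder≡sum-degree {n} [] = sym (sum-zero n)
  where
  sum-zero : ∀ n → sum {n} (λ _ → 0) ≡ 0
  sum-zero zero    = refl
  sum-zero (suc n) = sum-zero n
totalOrder≡sum-degree (H ∷ Hs) = sym (trans
  (∑-distrib-+ (λ v → indicator (inA H v) + indicator (inB H v)) (degree Hs))
  (cong₂ _+_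
    (trans (∑-distrib-+ (indicator ∘ inA H) (indicator ∘ inB H))
           (sym (cong₂ _+_ (∣p∣≡sum (sideA H)) (∣p∣≡sum (sideB H)))))
    (sym (totalOrder≡sum-degree Hs))))

sides-disjoint : {G : Graph n} (H : Biclique G) → ∀ v → inA H v ≡ true → inB H v ≡ true → ⊥
sides-disjoint {G = G} H v a b =
  case trans (sym (irrefl G v))
             (complete H v v (lookup⇒[]= v (sideA H) a) (lookup⇒[]= v (sideB H) b)) of λ ()

-- The form by pairs, rather than by a chosen missing side, passes to subsets of `I` and clashes
-- directly with a covered edge inside `I`.
Avoids : {G : Graph n} → (Fin n → Bool) → List (Biclique G) → Set
Avoids I Hs = ∀ H → H ∈ᴸ Hs → ∀ u v →
  inA H u ≡ true → inB H v ≡ true → I u ≡ true → I v ≡ true → ⊥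

-- The weights after the side a of the biclique (a , b) has been deleted.
reweigh : (a b : Bool) → ℕ → ℕ
reweigh true  _     w = 0
reweigh false true  w = 2 * w
reweigh false false w = w

-- Deleting a random side preserves the expected weight, since a vertex on one side gets 0 or
-- `2 * w`. A vertex on both sides would get 0 twice, hence the disjointness hypothesis.
reweigh-average : ∀ a b w → (a ≡ true → b ≡ true → ⊥) → w + w ≤ reweigh a b w + reweigh b a w
reweigh-average true  true  w dis = ⊥-elim (dis refl refl)
reweigh-average true  false w dis = ≤-reflexive (cong (w +_) (sym (+-identityʳ w)))
reweigh-average false true  w dis = ≤-reflexive (trans (cong (w +_) (sym (+-identityʳ w))) (sym (+-identityʳ _)))
reweigh-average false false w dis = ≤-refl

-- The doubled weight of a survivor on the other side is matched by the 1 that this biclique adds to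
-- its degree.
reweigh-degree : ∀ a b i w d →
  (if i then reweigh a b w * 2 ^ d else 0) ≤
  (if i ∧ not a then w * 2 ^ (indicator a + indicator b + d) else 0)
reweigh-degree a     b     false w d = z≤n
reweigh-degree true  b     true  w d = z≤n
reweigh-degree false true  true  w d = ≤-reflexive (identity w (2 ^ d))
  where
  identity : ∀ w p → 2 * w * p ≡ w * (2 * p)
  identity = solve-∀
reweigh-degree false false true  w d = ≤-refl

larger-half : ∀ {s x y} → s + s ≤ x + y → s ≤ x ⊎ s ≤ y
larger-half {s} {x} {y} le with x <? s
... | no  x≮s = inj₁ (≮⇒≥ x≮s)
... | yes x<s with y <? s
...   | no  y≮s = inj₂ (≮⇒≥ y≮s)
...   | yes y<s = ⊥-elim (≤⇒≯ le (+-mono-< x<s y<s))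

kept : ∀ i a → i ∧ not a ≡ true → i ≡ true
kept true a p = refl

deleted : ∀ i a → a ≡ true → i ∧ not a ≡ true → ⊥
deleted true  .true refl ()
deleted false .true refl ()

-- With w replaced by w / 2^degree, the bound says that I carries at least the
-- expected weight of a random choice of deleted sides.
transversal : {G : Graph n} (Hs : List (Biclique G)) (w : Fin n → ℕ) → Σ[ I ∈ (Fin n → Bool) ]
  Avoids I Hs × sum w ≤ sum (λ v → if I v then w v * 2 ^ degree Hs v else 0)
transversal [] w =
  (λ _ → true) , (λ _ ()) , sum-mono-≤ (λ v → ≤-reflexive (sym (*-identityʳ (w v))))
transversal {n} {G} (H ∷ Hs) w = pick (larger-half averaged)
  where
  wA wB : Fin n → ℕ
  wA v = reweigh (inA H v) (inB H v) (w v)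
  wB v = reweigh (inB H v) (inA H v) (w v)

  -- Method of conditional expectations: the two choices together carry at least twice the weight,
  -- so one of them loses nothing.
  averaged : sum w + sum w ≤ sum wA + sum wB
  averaged = subst₂ _≤_ (∑-distrib-+ w w) (∑-distrib-+ wA wB)
    (sum-mono-≤ λ v → reweigh-average (inA H v) (inB H v) (w v) (sides-disjoint H v))

  pick : sum w ≤ sum wA ⊎ sum w ≤ sum wB → Σ[ I ∈ (Fin n → Bool) ]
    Avoids I (H ∷ Hs) × sum w ≤ sum (λ v → if I v then w v * 2 ^ degree (H ∷ Hs) v else 0)
  pick (inj₁ le) with transversal Hs wA
  ... | I , av , le′ = (λ v → I v ∧ not (inA H v)) , avoids , ≤-trans le (≤-trans le′
          (sum-mono-≤ λ v → reweigh-degree (inA H v) (inB H v) (I v) (w v) (degree Hs v)))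
    where
    avoids : Avoids (λ v → I v ∧ not (inA H v)) (H ∷ Hs)
    avoids .H (here refl) u v a b p q = deleted (I u) (inA H u) a p
    avoids K  (there K∈)  u v a b p q = av K K∈ u v a b (kept (I u) _ p) (kept (I v) _ q)
  pick (inj₂ le) with transversal Hs wB
  ... | I , av , le′ = (λ v → I v ∧ not (inB H v)) , avoids , ≤-trans le (≤-trans le′
          (sum-mono-≤ λ v → subst
            (λ t → (if I v then wB v * 2 ^ degree Hs v else 0) ≤
                   (if I v ∧ not (inB H v) then w v * 2 ^ (t + degree Hs v) else 0))
            (+-comm (indicator (inB H v)) (indicator (inA H v)))
            (reweigh-degree (inB H v) (inA H v) (I v) (w v) (degree Hs v))))
    where
    avoids : Avoids (λ v → I v ∧ not (inB H v)) (H ∷ Hs)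
    avoids .H (here refl) u v a b p q = deleted (I v) (inB H v) b q
    avoids K  (there K∈)  u v a b p q = av K K∈ u v a b (kept (I u) _ p) (kept (I v) _ q)

independent : {G : Graph n} (Hs : List (Biclique G)) → Covers G Hs → ∀ {I} → Avoids I Hs →
  ∀ u v → adj G u v ≡ true → I u ≡ true → I v ≡ true → ⊥
independent Hs cov av u v uv p q with cov u v uv
... | H , H∈ , inj₁ (a , b) = av H H∈ u v ([]=⇒lookup a) ([]=⇒lookup b) p q
... | H , H∈ , inj₂ (a , b) = av H H∈ v u ([]=⇒lookup a) ([]=⇒lookup b) q p

-- Colouring

-- One vertex in one round: `u` says that it was uncoloured, `i` that it lies in the new class. If
-- missed, N = (N - e) + e gives equality; if caught, `e * p ≤ N` pays. The summand `e * g` on the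
-- right is the weight given to `transversal`, and cancels after summation.
potential-step : ∀ N e g p u i → e ≤ N → e * p ≤ N →
  N * (if u ∧ not i then g else 0) + (if i then (if u then e * g else 0) * p else 0) ≤
  (if u then (N ∸ e) * g else 0) + (if u then e * g else 0)
potential-step N e g p false false _ _ = ≤-reflexive (cong (_+ 0) (*-zeroʳ N))
potential-step N e g p false true  _ _ = ≤-reflexive (cong (_+ 0) (*-zeroʳ N))
potential-step N e g p true  false e≤N _ = ≤-reflexive (trans (+-identityʳ (N * g))
  (trans (cong (_* g) (sym (m∸n+n≡m e≤N))) (*-distribʳ-+ g (N ∸ e) e)))
potential-step N e g p true  true  e≤N ep≤N = begin
  N * 0 + e * g * p      ≡⟨ identity N e g p ⟩
  e * p * g              ≤⟨ *-monoˡ-≤ g ep≤N ⟩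
  N * g                  ≡⟨ cong (_* g) (m∸n+n≡m e≤N) ⟨
  (N ∸ e + e) * g        ≡⟨ *-distribʳ-+ g (N ∸ e) e ⟩
  (N ∸ e) * g + e * g    ∎
  where
  open ≤-Reasoning
  identity : ∀ N e g p → N * 0 + e * g * p ≡ e * p * g
  identity = solve-∀

module _ {G : Graph n} (Hs : List (Biclique G)) (cov : Covers G Hs)
         (N : ℕ) (e : Fin n → ℕ) (e*2^deg≤N : ∀ v → e v * 2 ^ degree Hs v ≤ N) where

  private
    e≤N : ∀ v → e v ≤ N
    e≤N v = ≤-trans (m≤m*n (e v) (2 ^ degree Hs v) {{m^n≢0 2 (degree Hs v)}}) (e*2^deg≤N v)

  -- With e = N 2^-degree, the expected number of vertices of U missed by j
  -- random independent sets is at most the right-hand sum divided by N^j.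
  partial-colouring : ∀ j (U : Fin n → Bool) → ∃[ x ] Σ[ f ∈ (Fin n → ℕ) ]
    (∀ v → U v ≡ true → f v < j + x) ×
    (∀ u v → U u ≡ true → U v ≡ true → adj G u v ≡ true → f u ≢ f v) ×
    N ^ j * x ≤ sum (λ v → if U v then (N ∸ e v) ^ j else 0)
  partial-colouring zero U with enumerate U
  ... | f , f< , inj = sum (indicator ∘ U) , f , f< , proper , ≤-reflexive (*-identityˡ _)
    where
    proper : ∀ u v → U u ≡ true → U v ≡ true → adj G u v ≡ true → f u ≢ f v
    proper u v p q uv e with inj u v p q e
    ... | refl = case trans (sym (irrefl G v)) uv of λ ()
  partial-colouring (suc j) U with
    -- The weight is the difference between N (N - e)^j and (N - e)^(j+1), the drop in the potential
    -- of `v` required in this round.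
    transversal Hs (λ v → if U v then e v * (N ∸ e v) ^ j else 0)
  ... | I , av , le with partial-colouring j (λ v → U v ∧ not (I v))
  ...   | x , f , f< , proper , bound = x , f′ , f′< , proper′ , bound′
    where
    -- Colour 0 is the class `I`; the colours of the remaining vertices move up by one.
    f′ : Fin n → ℕ
    f′ v = if I v then 0 else suc (f v)

    rest : ∀ v → U v ≡ true → I v ≡ false → U v ∧ not (I v) ≡ true
    rest v p q rewrite p | q = refl

    f′< : ∀ v → U v ≡ true → f′ v < suc j + x
    f′< v p with I v in eq
    ... | true  = s≤s z≤n
    ... | false = s≤s (f< v (rest v p eq))

    proper′ : ∀ u v → U u ≡ true → U v ≡ true → adj G u v ≡ true → f′ u ≢ f′ v
    proper′ u v p q uv with I u in equ | I v in eqv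
    ... | true  | true  = λ _ → independent Hs cov av u v uv equ eqv
    ... | true  | false = λ ()
    ... | false | true  = λ ()
    ... | false | false = proper u v (rest u p equ) (rest v q eqv) uv ∘ suc-injective

    g g′ h : Fin n → ℕ
    g  v = if U v ∧ not (I v) then (N ∸ e v) ^ j else 0
    g′ v = if U v then (N ∸ e v) ^ suc j else 0
    h  v = if U v then e v * (N ∸ e v) ^ j else 0

    hI : Fin n → ℕ
    hI v = if I v then h v * 2 ^ degree Hs v else 0

    step : N * sum g + sum h ≤ sum g′ + sum h
    step = begin
      N * sum g + sum h                ≤⟨ +-monoʳ-≤ (N * sum g) le ⟩
      N * sum g + sum hI               ≡⟨ cong (_+ sum hI) (*-distribˡ-sum N g) ⟩
      sum (λ v → N * g v) + sum hI     ≡⟨ ∑-distrib-+ (λ v → N * g v) hI ⟨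
      sum (λ v → N * g v + hI v)       ≤⟨ sum-mono-≤ (λ v → potential-step N (e v) ((N ∸ e v) ^ j)
                                            (2 ^ degree Hs v) (U v) (I v) (e≤N v) (e*2^deg≤N v)) ⟩
      sum (λ v → g′ v + h v)           ≡⟨ ∑-distrib-+ g′ h ⟩
      sum g′ + sum h                   ∎
      where open ≤-Reasoning

    bound′ : N ^ suc j * x ≤ sum g′
    bound′ = begin
      N * N ^ j * x    ≡⟨ *-assoc N (N ^ j) x ⟩
      N * (N ^ j * x)  ≤⟨ *-monoʳ-≤ N bound ⟩
      N * sum g        ≤⟨ +-cancelʳ-≤ (sum h) _ _ step ⟩
      sum g′           ∎
      where open ≤-Reasoning

chromatic-bound : ∀ {k} (G : Graph n) → ChromaticNumber G k → (Hs : List (Biclique G)) →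
  Covers G Hs → ∀ T → T * k ≤ T * 2 ^ T + totalOrder Hs
chromatic-bound {n} {k} G (_ , minimal) Hs cov T
  -- All vertices start uncoloured, and there are as many rounds as N = 2^T.
  with partial-colouring Hs cov (2 ^ T) (share T ∘ degree Hs)
         (λ v → share*2^d≤2^T T (degree Hs v)) (2 ^ T) (λ _ → true)
... | x , f , f< , proper , bound = begin
  T * k                        ≤⟨ *-monoʳ-≤ T k≤N+x ⟩
  T * (N + x)                  ≡⟨ *-distribˡ-+ T N x ⟩
  T * N + T * x                ≤⟨ +-monoʳ-≤ (T * N) Tx≤S ⟩
  T * N + totalOrder Hs        ∎
  where
  open ≤-Reasoning
  N = 2 ^ T

  k≤N+x : k ≤ N + x
  k≤N+x = ≮⇒≥ λ lt → minimal (N + x) lt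
    ( (λ v → fromℕ< (f< v refl))
    , λ u v uv eq → proper u v refl refl uv (fromℕ<-injective _ _ (f< u refl) (f< v refl) eq))

  -- The bound on `x` comes with the factor `N ^ N`, so the vertexwise estimates are summed at that
  -- scale before it is cancelled.
  scaled : N ^ N * (T * x) ≤ N ^ N * totalOrder Hs
  scaled = begin
    N ^ N * (T * x)                                   ≡⟨ identity (N ^ N) T x ⟩
    T * (N ^ N * x)                                   ≤⟨ *-monoʳ-≤ T bound ⟩
    T * sum (λ v → (N ∸ share T (degree Hs v)) ^ N)   ≡⟨ *-distribˡ-sum T (λ v → (N ∸ share T (degree Hs v)) ^ N) ⟩
    sum (λ v → T * (N ∸ share T (degree Hs v)) ^ N)   ≤⟨ sum-mono-≤ (λ v → share-bound T (degree Hs v)) ⟩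
    sum (λ v → degree Hs v * N ^ N)                   ≡⟨ sum-cong-≗ (λ v → *-comm (degree Hs v) (N ^ N)) ⟩
    sum (λ v → N ^ N * degree Hs v)                   ≡⟨ *-distribˡ-sum (N ^ N) (degree Hs) ⟨
    N ^ N * sum (degree Hs)                           ≡⟨ cong (N ^ N *_) (totalOrder≡sum-degree Hs) ⟨
    N ^ N * totalOrder Hs                             ∎
    where
    identity : ∀ p T x → p * (T * x) ≡ T * (p * x)
    identity = solve-∀

  Tx≤S : T * x ≤ totalOrder Hs
  Tx≤S = *-cancelˡ-≤ (N ^ N) {{m^n≢0 N N {{m^n≢0 2 T}}}} scaled

-- Choice of T

dyadic-bracket : ∀ b k → 1 ≤ b → b ≤ k → ∃[ t ] (2 ^ t * b ≤ k × k < 2 ^ suc t * b)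
dyadic-bracket b k 1≤b b≤k =
  -- The descent starts at exponent `k`, which is large enough because `k < 2 ^ k`.
  search k (<-≤-trans (n<2^n k) (m≤m*n (2 ^ k) b {{>-nonZero 1≤b}}))
  where
  search : ∀ s → k < 2 ^ s * b → ∃[ t ] (2 ^ t * b ≤ k × k < 2 ^ suc t * b)
  search zero    k< = ⊥-elim (<⇒≱ k< (subst (_≤ k) (sym (*-identityˡ b)) b≤k))
  search (suc s) k< with k <? 2 ^ s * b
  ... | yes k<′ = search s k<′
  ... | no  k≮  = s , ≮⇒≥ k≮ , k<

2^-cancel-< : ∀ {m n} → 2 ^ m < 2 ^ n → m < n
2^-cancel-< lt = ≰⇒> λ n≤m → <⇒≱ lt (^-monoʳ-≤ 2 n≤m)

-- In logarithms, T ≥ log k - log L - 1, so S ≥ T k - k ≥ k log k - k log L - 2k. The 2k becomes a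
-- factor 4 inside the k-th power, absorbed by q = qn/qd ≥ 4, while L is absorbed by p = pn/pd ≥ L.
boundHolds : ∀ k S L T → 2 ^ 4 ≤ L → 2 ^ L ≤ k → k ≤ 2 ^ suc T * L → T * k ≤ k + S → BoundHolds k S
boundHolds k S L T 16≤L 2^L≤k k≤2^T*2L Tk≤k+S pn pd qn qd 1≤pd _ p≥log q≥log = begin
  k ^ k * D ^ k                            ≡⟨ ^-distribʳ-* k D k ⟨
  (k * D) ^ k                              ≤⟨ ^-monoˡ-≤ k (*-monoˡ-≤ D k≤2^T*2L) ⟩
  (2 * 2 ^ T * L * D) ^ k                  ≡⟨ cong (_^ k) (identity₁ (2 ^ T) L D) ⟩
  (2 ^ T * (2 * L * D)) ^ k                ≡⟨ ^-distribʳ-* (2 ^ T) (2 * L * D) k ⟩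
  (2 ^ T) ^ k * (2 * L * D) ^ k            ≡⟨ cong (_* (2 * L * D) ^ k) (^-*-assoc 2 T k) ⟩
  2 ^ (T * k) * (2 * L * D) ^ k            ≤⟨ *-monoˡ-≤ ((2 * L * D) ^ k) (^-monoʳ-≤ 2 Tk≤k+S) ⟩
  2 ^ (k + S) * (2 * L * D) ^ k            ≡⟨ cong (_* (2 * L * D) ^ k) (^-distribˡ-+-* 2 k S) ⟩
  2 ^ k * 2 ^ S * (2 * L * D) ^ k          ≡⟨ identity₂ (2 ^ k) (2 ^ S) ((2 * L * D) ^ k) ⟩
  2 ^ S * (2 ^ k * (2 * L * D) ^ k)        ≡⟨ cong (2 ^ S *_) (^-distribʳ-* 2 (2 * L * D) k) ⟨
  2 ^ S * (2 * (2 * L * D)) ^ k            ≡⟨ cong (λ m → 2 ^ S * m ^ k) (identity₃ L pd qd) ⟩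
  2 ^ S * (L * pd * (4 * qd)) ^ k          ≤⟨ *-monoʳ-≤ (2 ^ S) (^-monoˡ-≤ k (*-mono-≤ Lpd≤pn 4qd≤qn)) ⟩
  2 ^ S * (pn * qn) ^ k                    ∎
  where
  open ≤-Reasoning
  D = pd * qd

  identity₁ : ∀ t L D → 2 * t * L * D ≡ t * (2 * L * D)
  identity₁ = solve-∀
  identity₂ : ∀ a b c → a * b * c ≡ b * (a * c)
  identity₂ = solve-∀
  identity₃ : ∀ L p q → 2 * (2 * L * (p * q)) ≡ L * p * (4 * q)
  identity₃ = solve-∀

  Lpd≤pn : L * pd ≤ pn
  Lpd≤pn = ^-cancelʳ-≤ 2 (s≤s (s≤s z≤n)) (begin
    2 ^ (L * pd)  ≡⟨ ^-*-assoc 2 L pd ⟨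
    (2 ^ L) ^ pd  ≤⟨ ^-monoˡ-≤ pd 2^L≤k ⟩
    k ^ pd        ≤⟨ p≥log ⟩
    2 ^ pn        ∎)

  -- q ≥ log p ≥ log L ≥ 4.
  4qd≤qn : 4 * qd ≤ qn
  4qd≤qn = ^-cancelʳ-≤ 2 (s≤s (s≤s z≤n))
    (*-cancelʳ-≤ _ _ (pd ^ qd) {{m^n≢0 pd qd {{>-nonZero 1≤pd}}}} (begin
      2 ^ (4 * qd) * pd ^ qd  ≡⟨ cong (_* pd ^ qd) (^-*-assoc 2 4 qd) ⟨
      (2 ^ 4) ^ qd * pd ^ qd  ≤⟨ *-monoˡ-≤ (pd ^ qd) (^-monoˡ-≤ qd 16≤L) ⟩
      L ^ qd * pd ^ qd        ≡⟨ ^-distribʳ-* L pd qd ⟨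
      (L * pd) ^ qd           ≤⟨ ^-monoˡ-≤ qd Lpd≤pn ⟩
      pn ^ qd                 ≤⟨ q≥log ⟩
      2 ^ qn * pd ^ qd        ∎))

theorem2 : ∃[ k₀ ] ∀ k → k ≥ k₀ → ∀ {n} (G : Graph n) → ChromaticNumber G k →
    (Hs : List (Biclique G)) → Covers G Hs → BoundHolds k (totalOrder Hs)
theorem2 = 2 ^ 16 , bound
  where
  bound : ∀ k → k ≥ 2 ^ 16 → ∀ {n} (G : Graph n) → ChromaticNumber G k →
    (Hs : List (Biclique G)) → Covers G Hs → BoundHolds k (totalOrder Hs)
  -- The two brackets make `L` the integer part of log k and `T` that of log (k / L). The threshold
  -- `2 ^ 16` ensures `16 ≤ L`.
  bound k k≥ G χ Hs cov with dyadic-bracket 1 k ≤-refl (≤-trans (m^n>0 2 16) k≥)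
  ... | L , lo , hi = conclude (dyadic-bracket L k 1≤L (≤-trans (<⇒≤ (n<2^n L)) 2^L≤k))
    where
    open ≤-Reasoning
    2^L≤k : 2 ^ L ≤ k
    2^L≤k = subst (_≤ k) (*-identityʳ (2 ^ L)) lo
    k<2^1+L : k < 2 ^ suc L
    k<2^1+L = subst (k <_) (*-identityʳ (2 ^ suc L)) hi
    16≤L : 16 ≤ L
    16≤L = ≤-pred (2^-cancel-< (≤-<-trans k≥ k<2^1+L))
    1≤L : 1 ≤ L
    1≤L = ≤-trans (s≤s z≤n) 16≤L

    conclude : ∃[ T ] (2 ^ T * L ≤ k × k < 2 ^ suc T * L) → BoundHolds k (totalOrder Hs)
    -- Since `T ≤ L` and `2 ^ T * L ≤ k`, the term `T * 2 ^ T` costs at most `k`.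
    conclude (T , lo′ , hi′) = boundHolds k (totalOrder Hs) L T 16≤L 2^L≤k (<⇒≤ hi′) (begin
      T * k                          ≤⟨ chromatic-bound G χ Hs cov T ⟩
      T * 2 ^ T + totalOrder Hs      ≤⟨ +-monoˡ-≤ (totalOrder Hs) (*-monoˡ-≤ (2 ^ T) T≤L) ⟩
      L * 2 ^ T + totalOrder Hs      ≡⟨ cong (_+ totalOrder Hs) (*-comm L (2 ^ T)) ⟩
      2 ^ T * L + totalOrder Hs      ≤⟨ +-monoˡ-≤ (totalOrder Hs) lo′ ⟩
      k + totalOrder Hs              ∎)
      where
      2^T≤k : 2 ^ T ≤ k
      2^T≤k = ≤-trans (m≤m*n (2 ^ T) L {{>-nonZero 1≤L}}) lo′
      T≤L : T ≤ L
      T≤L = ≤-pred (2^-cancel-< (≤-<-trans 2^T≤k k<2^1+L))
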